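{- (a) Spoiler can win the $3$-round MS game on $(\{\mathsf{RT}(4)\},\{\mathsf{RT}(3)\})$ without playing on top. (b) There is no first-order sentence $\psi$ with $3$ quantifiers such that $\psi$ is a separating sentence for $(\{\mathsf{RT}(4)\},\{\mathsf{RT}(3)\})$ and both $\psi$ and $\neg\psi$ are non-replicating sentences.
   Context: Schema: one binary relation symbol $<$, no constants. $\mathsf{RT}(4)$: rooted tree with nodes $B1,B11,B12,B13,B21,B22$, root $B1$, edges $B1$–$B11$, $B11$–$B12$, $B12$–$B13$, $B1$–$B21$, $B21$–$B22$. $\mathsf{RT}(3)$: rooted tree with nodes $L1,L11,L12,L21,L22$, root $L1$, edges $L1$–$L11$, $L11$–$L12$, $L1$–$L21$, $L21$–$L22$. $x<y$ iff $x$ is a proper descendant of $y$. A separating sentence for $(\mathcal{A},\mathcal{B})$ is true on all of $\mathcal{A}$ and false on all of $\mathcal{B}$. A type over distinct variables $x_1,\dots,x_r$ is a (consistent) conjunction of atomic and negated atomic formulas containing, for each atomic formula in these variables, exactly one of it or its negation. Sentences with $r$ quantifiers are taken in the form $\psi=Q_1x_1\dots Q_rx_r\,\theta$, $\theta$ a disjunction of types; $\neg\psi$ is $\overline{Q_1}x_1\dots\overline{Q_r}x_r\,\theta'$ with dual quantifiers and $\theta'$ the disjunction of the consistent types not in $\theta$. A disjunct type $t$ of $\theta$ is non-replicating in $\psi$ if each equality $x_i=x_j$ ($i\ne j$) in $t$ has either both variables universally quantified, or one universal and one existential with the existential occurring earlier in the prefix (and each equality $c=x_j$ with $c$ a constant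 has $x_j$ universal). $\psi$ is non-replicating if all disjuncts of $\theta$ are non-replicating in $\psi$. MS game: pebbled structures carry pebble $i$ on element $a_i$; two form a matching pair if $a_i\mapsto b_i$ is an isomorphism of induced substructures. In the $r$-round MS game on $(\mathcal{A},\mathcal{B})$, in each round $t$ Spoiler picks a side and places pebble $t$ on an element of each pebbled structure there; Duplicator, for each pebbled structure on the other side, may make any number of copies and places pebble $t$ on an element of each copy; Spoiler wins once no left structure forms a matching pair with a right one; Duplicator wins if a matching pair remains after round $r$. Spoiler plays on top if he places a pebble on an element already carrying a pebble. -}

module Defs where

open import Data.Bool using (Bool; true; false; not; T; _∨_)
open import Data.Nat using (ℕ; zero; suc)
open import Data.Fin using (Fin; _<_)
open import Data.Vec using (Vec; []; _∷_; lookup; tabulate)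
open import Data.List using (List; []; _∷_)
open import Data.Bool.ListAction using (any)
open import Data.List.Membership.Propositional using (_∈_)
open import Data.List.Relation.Binary.Pointwise using (Pointwise)
open import Data.Maybe using (Maybe; just; nothing)
open import Data.Product using (Σ; ∃; _×_; _,_)
open import Data.Sum using (_⊎_)
open import Relation.Nullary using (¬_)
open import Relation.Nullary.Decidable using (⌊_⌋)
open import Relation.Binary.Definitions using (DecidableEquality)
open import Relation.Binary.PropositionalEquality using (_≡_; _≢_; refl)
open import Function.Bundles using (_⇔_)

record Structure : Set₁ where
  field
    Carrier : Set
    _≟_     : DecidableEquality Carrier
    rel     : Carrier → Carrier → Bool

open Structure public

-- Rooted trees with  x < y  iff  x is a proper descendant of y.
-- A tree is given by its parent function; proper ancestors are obtained
-- by iterating the parent function (fuel = a bound on the depth).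

ancestors : {N : Set} → (N → Maybe N) → ℕ → N → List N
ancestors par zero    x = []
ancestors par (suc f) x with par x
... | nothing = []
... | just p  = p ∷ ancestors par f p

treeStructure : (N : Set) → DecidableEquality N → (N → Maybe N) → ℕ → Structure
treeStructure N eq par fuel = record
  { Carrier = N
  ; _≟_     = eq
  ; rel     = λ x y → any (λ z → ⌊ eq z y ⌋) (ancestors par fuel x)
  }

data NodeRT4 : Set where
  B1 B11 B12 B13 B21 B22 : NodeRT4

parentRT4 : NodeRT4 → Maybe NodeRT4
parentRT4 B1  = nothing
parentRT4 B11 = just B1
parentRT4 B12 = just B11
parentRT4 B13 = just B12
parentRT4 B21 = just B1
parentRT4 B22 = just B21

_≟RT4_ : DecidableEquality NodeRT4
B1  ≟RT4 B1  = Relation.Nullary.yes refl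
B11 ≟RT4 B11 = Relation.Nullary.yes refl
B12 ≟RT4 B12 = Relation.Nullary.yes refl
B13 ≟RT4 B13 = Relation.Nullary.yes refl
B21 ≟RT4 B21 = Relation.Nullary.yes refl
B22 ≟RT4 B22 = Relation.Nullary.yes refl
B1  ≟RT4 B11 = Relation.Nullary.no λ ()
B1  ≟RT4 B12 = Relation.Nullary.no λ ()
B1  ≟RT4 B13 = Relation.Nullary.no λ ()
B1  ≟RT4 B21 = Relation.Nullary.no λ ()
B1  ≟RT4 B22 = Relation.Nullary.no λ ()
B11 ≟RT4 B1  = Relation.Nullary.no λ ()
B11 ≟RT4 B12 = Relation.Nullary.no λ ()
B11 ≟RT4 B13 = Relation.Nullary.no λ ()
B11 ≟RT4 B21 = Relation.Nullary.no λ ()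
B11 ≟RT4 B22 = Relation.Nullary.no λ ()
B12 ≟RT4 B1  = Relation.Nullary.no λ ()
B12 ≟RT4 B11 = Relation.Nullary.no λ ()
B12 ≟RT4 B13 = Relation.Nullary.no λ ()
B12 ≟RT4 B21 = Relation.Nullary.no λ ()
B12 ≟RT4 B22 = Relation.Nullary.no λ ()
B13 ≟RT4 B1  = Relation.Nullary.no λ ()
B13 ≟RT4 B11 = Relation.Nullary.no λ ()
B13 ≟RT4 B12 = Relation.Nullary.no λ ()
B13 ≟RT4 B21 = Relation.Nullary.no λ ()
B13 ≟RT4 B22 = Relation.Nullary.no λ ()
B21 ≟RT4 B1  = Relation.Nullary.no λ ()
B21 ≟RT4 B11 = Relation.Nullary.no λ ()
B21 ≟RT4 B12 = Relation.Nullary.no λ ()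
B21 ≟RT4 B13 = Relation.Nullary.no λ ()
B21 ≟RT4 B22 = Relation.Nullary.no λ ()
B22 ≟RT4 B1  = Relation.Nullary.no λ ()
B22 ≟RT4 B11 = Relation.Nullary.no λ ()
B22 ≟RT4 B12 = Relation.Nullary.no λ ()
B22 ≟RT4 B13 = Relation.Nullary.no λ ()
B22 ≟RT4 B21 = Relation.Nullary.no λ ()

RT4 : Structure
RT4 = treeStructure NodeRT4 _≟RT4_ parentRT4 6

data NodeRT3 : Set where
  L1 L11 L12 L21 L22 : NodeRT3

parentRT3 : NodeRT3 → Maybe NodeRT3
parentRT3 L1  = nothing
parentRT3 L11 = just L1
parentRT3 L12 = just L11
parentRT3 L21 = just L1
parentRT3 L22 = just L21

_≟RT3_ : DecidableEquality NodeRT3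
L1  ≟RT3 L1  = Relation.Nullary.yes refl
L11 ≟RT3 L11 = Relation.Nullary.yes refl
L12 ≟RT3 L12 = Relation.Nullary.yes refl
L21 ≟RT3 L21 = Relation.Nullary.yes refl
L22 ≟RT3 L22 = Relation.Nullary.yes refl
L1  ≟RT3 L11 = Relation.Nullary.no λ ()
L1  ≟RT3 L12 = Relation.Nullary.no λ ()
L1  ≟RT3 L21 = Relation.Nullary.no λ ()
L1  ≟RT3 L22 = Relation.Nullary.no λ ()
L11 ≟RT3 L1  = Relation.Nullary.no λ ()
L11 ≟RT3 L12 = Relation.Nullary.no λ ()
L11 ≟RT3 L21 = Relation.Nullary.no λ ()
L11 ≟RT3 L22 = Relation.Nullary.no λ ()
L12 ≟RT3 L1  = Relation.Nullary.no λ ()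
L12 ≟RT3 L11 = Relation.Nullary.no λ ()
L12 ≟RT3 L21 = Relation.Nullary.no λ ()
L12 ≟RT3 L22 = Relation.Nullary.no λ ()
L21 ≟RT3 L1  = Relation.Nullary.no λ ()
L21 ≟RT3 L11 = Relation.Nullary.no λ ()
L21 ≟RT3 L12 = Relation.Nullary.no λ ()
L21 ≟RT3 L22 = Relation.Nullary.no λ ()
L22 ≟RT3 L1  = Relation.Nullary.no λ ()
L22 ≟RT3 L11 = Relation.Nullary.no λ ()
L22 ≟RT3 L12 = Relation.Nullary.no λ ()
L22 ≟RT3 L21 = Relation.Nullary.no λ ()

RT3 : Structure
RT3 = treeStructure NodeRT3 _≟RT3_ parentRT3 5

-- MS game.  Since both sides are singletons {A} and {B}, every pebbled
-- structure on the left is a copy of A and every one on the right a copy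
-- of B; a pebbled structure with t pebbles placed is a vector of the t
-- pebbled elements, NEWEST pebble first (index 0 = pebble t).

Board : Structure → ℕ → Set
Board A t = Vec (Carrier A) t

-- a_i ↦ b_i is an isomorphism of induced substructures (no constants):
-- well defined and injective, and preserves/reflects <.
MatchingPair : (A B : Structure) {t : ℕ} → Board A t → Board B t → Set
MatchingPair A B {t} a b =
  (i j : Fin t) →
    (lookup a i ≡ lookup a j ⇔ lookup b i ≡ lookup b j) ×
    (rel A (lookup a i) (lookup a j) ≡ rel B (lookup b i) (lookup b j))

NoMatchingPair : (A B : Structure) {t : ℕ} →
                 List (Board A t) → List (Board B t) → Set
NoMatchingPair A B L R =
  ∀ a b → a ∈ L → b ∈ R → ¬ MatchingPair A B a b

SpoilerMove : (A : Structure) (noTop : Bool) {t : ℕ} →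
              List (Board A (suc t)) → List (Board A t) → Set
SpoilerMove A noTop new old =
  Pointwise (λ b' b → Σ (Carrier A) λ x →
                (b' ≡ x ∷ b) × (T noTop → ∀ i → x ≢ lookup b i))
            new old

-- Duplicator replaces each pebbled structure of the other side by a
-- (nonempty) collection of copies, each with the new pebble placed on some
-- element: every new board extends an old one, and every old board has at
-- least one extension among the new ones.
DuplicatorMove : (A : Structure) {t : ℕ} →
                 List (Board A (suc t)) → List (Board A t) → Set
DuplicatorMove A new old =
  (∀ b' → b' ∈ new → Σ _ λ b → Σ (Carrier A) λ x → b ∈ old × b' ≡ x ∷ b) ×
  (∀ b → b ∈ old → Σ (Carrier A) λ x → (x ∷ b) ∈ new)

data SpoilerWins (A B : Structure) (noTop : Bool) :
     (k t : ℕ) → List (Board A t) → List (Board B t) → Set where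
  won    : ∀ {k t L R} → NoMatchingPair A B L R → SpoilerWins A B noTop k t L R
  playL  : ∀ {k t L R} (L' : List (Board A (suc t))) →
           SpoilerMove A noTop L' L →
           (∀ R' → DuplicatorMove B R' R → SpoilerWins A B noTop k (suc t) L' R') →
           SpoilerWins A B noTop (suc k) t L R
  playR  : ∀ {k t L R} (R' : List (Board B (suc t))) →
           SpoilerMove B noTop R' R →
           (∀ L' → DuplicatorMove A L' L → SpoilerWins A B noTop k (suc t) L' R') →
           SpoilerWins A B noTop (suc k) t L R

SpoilerWinsMS : (r : ℕ) (noTop : Bool) (A B : Structure) → Set
SpoilerWinsMS r noTop A B = SpoilerWins A B noTop r 0 ([] ∷ []) ([] ∷ [])

data Quant : Set where
  ∀q ∃q : Quant

dual : Quant → Quant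
dual ∀q = ∃q
dual ∃q = ∀q

-- A complete assignment of truth values to the atomic formulas over
-- x₁..x_r:  eqs i j  is the value of  x_i = x_j,  lts i j  of  x_i < x_j.
record Ty (r : ℕ) : Set where
  constructor mkTy
  field
    eqs : Vec (Vec Bool r) r
    lts : Vec (Vec Bool r) r

at : {r : ℕ} → Vec (Vec Bool r) r → Fin r → Fin r → Bool
at M i j = lookup (lookup M i) j

-- Consistency of such a conjunction of literals (pure FO with one binary
-- relation symbol): equality is an equivalence relation and < respects it.
Consistent : {r : ℕ} → Ty r → Set
Consistent {r} (mkTy E R) =
  (∀ i → at E i i ≡ true) ×
  (∀ i j → at E i j ≡ true → at E j i ≡ true) ×
  (∀ i j k → at E i j ≡ true → at E j k ≡ true → at E i k ≡ true) ×
  (∀ i i' j j' → at E i i' ≡ true → at E j j' ≡ true → at R i j ≡ at R i' j')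

-- θ is represented by the set of types it is the disjunction of, as a
-- Boolean predicate; its disjuncts are the consistent t with θ t ≡ true.
record Sentence (r : ℕ) : Set where
  constructor sentence
  field
    prefix : Vec Quant r
    matrix : Ty r → Bool

open Sentence public

typeOf : (A : Structure) {r : ℕ} → Vec (Carrier A) r → Ty r
typeOf A v = mkTy
  (tabulate λ i → tabulate λ j → ⌊ _≟_ A (lookup v i) (lookup v j) ⌋)
  (tabulate λ i → tabulate λ j → rel A (lookup v i) (lookup v j))

evalPrefix : (A : Structure) {k : ℕ} → Vec Quant k → (Vec (Carrier A) k → Set) → Set
evalPrefix A []        P = P []
evalPrefix A (∀q ∷ qs) P = (x : Carrier A) → evalPrefix A qs (λ v → P (x ∷ v))
evalPrefix A (∃q ∷ qs) P = Σ (Carrier A) λ x → evalPrefix A qs (λ v → P (x ∷ v))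

_⊨_ : (A : Structure) {r : ℕ} → Sentence r → Set
A ⊨ ψ = evalPrefix A (prefix ψ) (λ v → matrix ψ (typeOf A v) ≡ true)

-- ¬ψ : dual quantifiers, disjunction of the consistent types not in θ
negS : {r : ℕ} → Sentence r → Sentence r
negS (sentence qs θ) = sentence (Data.Vec.map dual qs) (λ t → not (θ t))

Separates : {r : ℕ} → Sentence r → Structure → Structure → Set
Separates ψ A B = (A ⊨ ψ) × ¬ (B ⊨ ψ)

NonReplicatingType : {r : ℕ} → Vec Quant r → Ty r → Set
NonReplicatingType {r} qs t =
  (i j : Fin r) → i ≢ j → at (Ty.eqs t) i j ≡ true →
    (lookup qs i ≡ ∀q × lookup qs j ≡ ∀q) ⊎
    (lookup qs i ≡ ∀q × lookup qs j ≡ ∃q × j < i) ⊎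
    (lookup qs i ≡ ∃q × lookup qs j ≡ ∀q × i < j)

NonReplicating : {r : ℕ} → Sentence r → Set
NonReplicating ψ =
  ∀ t → Consistent t → matrix ψ t ≡ true → NonReplicatingType (prefix ψ) t

{-# OPTIONS --safe #-}
-- (a) Spoiler pebbles B12.  If Duplicator puts x on L1, he puts y below it, and then Duplicator's y
-- is B13 on the boards still matching: he puts z on B1, above both, but nothing is above L1.  If x is
-- L11 or L21, he puts y on L1; the matching y is B1 or B11, and he puts z between x and y or above
-- both, where RT3 has no room.  If x is a leaf L12 or L22, he puts y on the other branch and z on B13
-- below B12.
--
-- (b) If ψ and ¬ψ are both non-replicating, a type containing xᵢ = xⱼ with i < j is a disjunct of θ
-- exactly when the later quantifier Qⱼ is universal.  The type with x₁ = x₂ = x₃ therefore forces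
-- Q₂ = Q₃.  If Q₂ = Q₃ = ∃, then θ holds only of triples of distinct elements, and if Q₂ = Q₃ = ∀,
-- it fails only on such triples.  So Duplicator need only answer moves to distinct elements, and
-- these she can always answer, carrying the truth of ψ from RT4 over to RT3.
module Submission where

open import Defs
open import Data.Bool using (Bool; true; false; not)
import Data.Bool.Properties as Bool
open import Data.Fin using (Fin; zero; suc; _<_; #_)
open import Data.Fin.Properties using (<-irrefl; <-asym)
open import Data.List using (List; []; _∷_; map)
open import Data.List.Membership.Propositional using (_∈_; lose)
open import Data.List.Membership.Propositional.Properties using (∈-map⁻)
import Data.List.Membership.DecPropositional as DecMembership
open import Data.List.Relation.Binary.Pointwise using ([]; _∷_)
import Data.List.Relation.Unary.All as All
open import Data.List.Relation.Unary.Any as Any using (here; there)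
open import Data.Nat using (ℕ; suc; s≤s; z≤n)
open import Data.Product using (Σ; ∃; ∃₂; _×_; _,_; proj₁; proj₂)
open import Data.Sum using (inj₁; inj₂)
open import Data.Vec as Vec using (Vec; []; _∷_; lookup; tabulate)
open import Data.Vec.Properties using (≡-dec; tabulate-cong; lookup∘tabulate; lookup-map)
open import Function.Base using (_∘_)
open import Relation.Nullary using (¬_; Dec; yes; no; contradiction)
open import Relation.Nullary.Decidable
  using (⌊_⌋; map′; _×-dec_; _→-dec_; ¬?; from-yes; does-⇔; isYes≗does; dec-true)
open import Relation.Binary.PropositionalEquality
  using (_≡_; _≢_; refl; sym; trans; cong; cong₂; module ≡-Reasoning)
open import Relation.Unary using (Decidable)

private variable
  r t : ℕ

-- Decidability by finite search.

_≟Ty_ : (s t : Ty r) → Dec (s ≡ t)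
mkTy E R ≟Ty mkTy E′ R′ =
  map′ (λ (p , q) → cong₂ mkTy p q) (λ { refl → refl , refl })
       (≡-dec (≡-dec Bool._≟_) E E′ ×-dec ≡-dec (≡-dec Bool._≟_) R R′)

record Finite (A : Set) : Set where
  field
    elements : List A
    complete : ∀ x → x ∈ elements

  ∀? : {P : A → Set} → Decidable P → Dec (∀ x → P x)
  ∀? P? = map′ (λ ps x → All.lookup ps (complete x)) (λ p → All.universal p elements)
               (All.all? P? elements)

  ∃? : {P : A → Set} → Decidable P → Dec (∃ P)
  ∃? P? = map′ Any.satisfied (λ (x , p) → lose (complete x) p) (Any.any? P? elements)

open Finite

finiteRT4 : Finite NodeRT4
finiteRT4 .elements = B1 ∷ B11 ∷ B12 ∷ B13 ∷ B21 ∷ B22 ∷ []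
finiteRT4 .complete = λ where
    B1  → from-yes (B1  ∈? finiteRT4 .elements)
    B11 → from-yes (B11 ∈? finiteRT4 .elements)
    B12 → from-yes (B12 ∈? finiteRT4 .elements)
    B13 → from-yes (B13 ∈? finiteRT4 .elements)
    B21 → from-yes (B21 ∈? finiteRT4 .elements)
    B22 → from-yes (B22 ∈? finiteRT4 .elements)
  where open DecMembership _≟RT4_ using (_∈?_)

finiteRT3 : Finite NodeRT3
finiteRT3 .elements = L1 ∷ L11 ∷ L12 ∷ L21 ∷ L22 ∷ []
finiteRT3 .complete = λ where
    L1  → from-yes (L1  ∈? finiteRT3 .elements)
    L11 → from-yes (L11 ∈? finiteRT3 .elements)
    L12 → from-yes (L12 ∈? finiteRT3 .elements)
    L21 → from-yes (L21 ∈? finiteRT3 .elements)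
    L22 → from-yes (L22 ∈? finiteRT3 .elements)
  where open DecMembership _≟RT3_ using (_∈?_)

-- Turns the absence of matching pairs into an inequality of Boolean tables, which finite search can
-- decide.
matchingPair⇒typeOf≡ : ∀ A B (a : Board A t) (b : Board B t) →
                       MatchingPair A B a b → typeOf A a ≡ typeOf B b
matchingPair⇒typeOf≡ A B a b match = cong₂ mkTy
  (tabulate-cong λ i → tabulate-cong λ j → sameEquality i j)
  (tabulate-cong λ i → tabulate-cong λ j → proj₂ (match i j))
  where
  sameEquality : ∀ i j → ⌊ _≟_ A (lookup a i) (lookup a j) ⌋ ≡ ⌊ _≟_ B (lookup b i) (lookup b j) ⌋
  sameEquality i j = begin
    ⌊ a≟ ⌋          ≡⟨ isYes≗does a≟ ⟩
    Dec.does a≟     ≡⟨ does-⇔ (proj₁ (match i j)) a≟ b≟ ⟩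
    Dec.does b≟     ≡⟨ isYes≗does b≟ ⟨
    ⌊ b≟ ⌋          ∎
    where
    open ≡-Reasoning
    a≟ = _≟_ A (lookup a i) (lookup a j)
    b≟ = _≟_ B (lookup b i) (lookup b j)

-- The game

extendAll : (A : Structure) → (Board A t → Carrier A) → List (Board A t) → List (Board A (suc t))
extendAll A f = map (λ b → f b ∷ b)

extendAll-spoilerMove : ∀ A (f : Board A t → Carrier A) bs →
                        (∀ {b} → b ∈ bs → ∀ i → f b ≢ lookup b i) →
                        SpoilerMove A true (extendAll A f bs) bs
extendAll-spoilerMove A f []       fresh = []
extendAll-spoilerMove A f (b ∷ bs) fresh =
  (f b , refl , λ _ → fresh (here refl)) ∷ extendAll-spoilerMove A f bs (fresh ∘ there)

secondMove : NodeRT3 → NodeRT3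
secondMove L1  = L11
secondMove L11 = L1
secondMove L12 = L21
secondMove L21 = L1
secondMove L22 = L11

-- A left board shows only `B12` and `y`, so one choice of `z` must serve against every `x`.
thirdMove : NodeRT4 → NodeRT4
thirdMove B1  = B11
thirdMove B11 = B1
-- A filler: `y` on `B12` repeats a pebble, while the two pebbles on each right board are distinct,
-- so nothing matches any more.
thirdMove B12 = B1
thirdMove B13 = B1
thirdMove B21 = B13
thirdMove B22 = B13

secondMove-fresh : ∀ x → secondMove x ≢ x
secondMove-fresh = from-yes (∀? finiteRT3 λ x → ¬? (secondMove x ≟RT3 x))

thirdMove-fresh : ∀ y → thirdMove y ≢ y × thirdMove y ≢ B12
thirdMove-fresh =
  from-yes (∀? finiteRT4 λ y → ¬? (thirdMove y ≟RT4 y) ×-dec ¬? (thirdMove y ≟RT4 B12))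

-- All 150 combinations of Duplicator's answers are checked, so it does not matter how many copies
-- she makes.
finalTypesDiffer : ∀ y x z → typeOf RT4 (thirdMove y ∷ y ∷ B12 ∷ []) ≢
                             typeOf RT3 (z ∷ secondMove x ∷ x ∷ [])
finalTypesDiffer = from-yes
  (∀? finiteRT4 λ y → ∀? finiteRT3 λ x → ∀? finiteRT3 λ z →
    ¬? (typeOf RT4 (thirdMove y ∷ y ∷ B12 ∷ []) ≟Ty typeOf RT3 (z ∷ secondMove x ∷ x ∷ [])))

spoilerWins : SpoilerWinsMS 3 true RT4 RT3
spoilerWins =
  playL ((B12 ∷ []) ∷ []) ((B12 , refl , λ _ ()) ∷ []) λ R₁ dup₁ →
  playR (extendAll RT3 g R₁) (extendAll-spoilerMove RT3 g R₁ (g-fresh dup₁)) λ L₂ dup₂ →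
  playL (extendAll RT4 h L₂) (extendAll-spoilerMove RT4 h L₂ (h-fresh dup₂)) λ R₃ dup₃ →
  won (separated dup₁ dup₂ dup₃)
  where
  g : Board RT3 1 → NodeRT3
  g (x ∷ []) = secondMove x

  h : Board RT4 2 → NodeRT4
  h (y ∷ _ ∷ []) = thirdMove y

  g-fresh : ∀ {R₁} → DuplicatorMove RT3 R₁ ([] ∷ []) →
            ∀ {b} → b ∈ R₁ → ∀ i → g b ≢ lookup b i
  g-fresh _ {x ∷ []} _ zero = secondMove-fresh x

  h-fresh : ∀ {L₂} → DuplicatorMove RT4 L₂ ((B12 ∷ []) ∷ []) →
            ∀ {b} → b ∈ L₂ → ∀ i → h b ≢ lookup b i
  h-fresh dup b∈ i with proj₁ dup _ b∈
  h-fresh dup b∈ zero       | _ , y , here refl , refl = proj₁ (thirdMove-fresh y)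
  h-fresh dup b∈ (suc zero) | _ , y , here refl , refl = proj₂ (thirdMove-fresh y)

  separated : ∀ {R₁ L₂ R₃} → DuplicatorMove RT3 R₁ ([] ∷ []) →
              DuplicatorMove RT4 L₂ ((B12 ∷ []) ∷ []) →
              DuplicatorMove RT3 R₃ (extendAll RT3 g R₁) →
              NoMatchingPair RT4 RT3 (extendAll RT4 h L₂) R₃
  separated dup₁ dup₂ dup₃ a b a∈ b∈ match
    with ∈-map⁻ _ a∈ | proj₁ dup₃ b b∈
  ... | a₂ , a₂∈ , refl | b₂ , z , b₂∈ , refl
    with proj₁ dup₂ a₂ a₂∈ | ∈-map⁻ _ b₂∈
  ... | _ , y , here refl , refl | x ∷ [] , _ , refl =
    finalTypesDiffer y x z (matchingPair⇒typeOf≡ RT4 RT3 a b match)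

-- Types of tuples

at-tabulate : (f : Fin r → Fin r → Bool) → ∀ i j → at (tabulate λ i → tabulate (f i)) i j ≡ f i j
at-tabulate f i j =
  trans (cong (λ row → lookup row j) (lookup∘tabulate _ i)) (lookup∘tabulate (f i) j)

module _ (A : Structure) (v : Vec (Carrier A) r) where

  private
    E = Ty.eqs (typeOf A v)
    R = Ty.lts (typeOf A v)

  at-eqs : ∀ i j → at E i j ≡ ⌊ _≟_ A (lookup v i) (lookup v j) ⌋
  at-eqs = at-tabulate _

  ≡⇒at-eqs : ∀ {i j} → lookup v i ≡ lookup v j → at E i j ≡ true
  ≡⇒at-eqs {i} {j} eq =
    trans (at-eqs i j) (trans (isYes≗does (_≟_ A _ _)) (dec-true (_≟_ A _ _) eq))

  at-eqs⇒≡ : ∀ {i j} → at E i j ≡ true → lookup v i ≡ lookup v j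
  at-eqs⇒≡ {i} {j} eq with _≟_ A (lookup v i) (lookup v j) | at-eqs i j
  ... | yes p | _  = p
  ... | no  _ | eq′ = contradiction (trans (sym eq) eq′) λ ()

  -- `NonReplicating` constrains consistent types only; this makes it applicable to realised ones.
  typeOf-consistent : Consistent (typeOf A v)
  typeOf-consistent =
    (λ i → ≡⇒at-eqs refl) ,
    (λ i j p → ≡⇒at-eqs (sym (at-eqs⇒≡ p))) ,
    (λ i j k p q → ≡⇒at-eqs (trans (at-eqs⇒≡ p) (at-eqs⇒≡ q))) ,
    (λ i i′ j j′ p q → trans (at-tabulate _ i j)
      (trans (cong₂ (rel A) (at-eqs⇒≡ p) (at-eqs⇒≡ q)) (sym (at-tabulate _ i′ j′))))

-- Sentences that are non-replicating together with their negations

isUniversal : Quant → Bool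
isUniversal ∀q = true
isUniversal ∃q = false

-- Two of the three permitted cases make `j` universal; the other places `j` before `i`.
laterUniversal : ∀ (qs : Vec Quant r) t → NonReplicatingType qs t →
                 ∀ i j → i < j → at (Ty.eqs t) i j ≡ true → lookup qs j ≡ ∀q
laterUniversal qs t nr i j i<j eq with nr i j (λ i≡j → <-irrefl i≡j i<j) eq
... | inj₁ (_ , q)              = q
... | inj₂ (inj₁ (_ , _ , j<i)) = contradiction j<i (<-asym i<j)
... | inj₂ (inj₂ (_ , q , _))   = q

dual≡∀⇒isUniversal≡false : ∀ q → dual q ≡ ∀q → isUniversal q ≡ false
dual≡∀⇒isUniversal≡false ∃q _ = refl

-- The type is a disjunct of `ψ` or of `negS ψ`. In the first case `laterUniversal` puts `∀q` at
-- `j`; in the second it does so in the dual prefix, so the original has `∃q` there.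
matrix-coincidence : ∀ (ψ : Sentence r) → NonReplicating ψ → NonReplicating (negS ψ) →
                     ∀ A v i j → i < j → lookup v i ≡ lookup v j →
                     matrix ψ (typeOf A v) ≡ isUniversal (lookup (prefix ψ) j)
matrix-coincidence (sentence qs θ) nr nr¬ A v i j i<j eq with θ (typeOf A v) in val
... | true  = sym (cong isUniversal
      (laterUniversal qs (typeOf A v) (nr (typeOf A v) (typeOf-consistent A v) val)
                      i j i<j (≡⇒at-eqs A v eq)))
... | false = sym (dual≡∀⇒isUniversal≡false (lookup qs j) (trans (sym (lookup-map j dual qs))
      (laterUniversal (Vec.map dual qs) (typeOf A v)
                      (nr¬ (typeOf A v) (typeOf-consistent A v) (cong not val))
                      i j i<j (≡⇒at-eqs A v eq))))

Distinct : (A : Structure) → (x y z : Carrier A) → Set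
Distinct A x y z = x ≢ y × x ≢ z × y ≢ z

distinct? : ∀ A x y z → Dec (Distinct A x y z)
distinct? A x y z = ¬? (_≟_ A x y) ×-dec ¬? (_≟_ A x z) ×-dec ¬? (_≟_ A y z)

module _ (q : Quant) (θ : Ty 3 → Bool) (A : Structure) (x y z : Carrier A) where

  private
    v : Vec (Carrier A) 3
    v = x ∷ y ∷ z ∷ []

  -- In any pair the later variable is one of the last two, so `q` can be arbitrary.
  ∃∃-distinct : let ψ = sentence (q ∷ ∃q ∷ ∃q ∷ []) θ in
                NonReplicating ψ → NonReplicating (negS ψ) →
                θ (typeOf A v) ≡ true → Distinct A x y z
  ∃∃-distinct nr nr¬ holds =
    (λ x≡y → refute (coincide (# 0) (# 1) (s≤s z≤n) x≡y)) ,
    (λ x≡z → refute (coincide (# 0) (# 2) (s≤s z≤n) x≡z)) ,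
    (λ y≡z → refute (coincide (# 1) (# 2) (s≤s (s≤s z≤n)) y≡z))
    where
    coincide : ∀ i j → i < j → lookup v i ≡ lookup v j →
               θ (typeOf A v) ≡ isUniversal (lookup (q ∷ ∃q ∷ ∃q ∷ []) j)
    coincide = matrix-coincidence (sentence (q ∷ ∃q ∷ ∃q ∷ []) θ) nr nr¬ A v

    refute : θ (typeOf A v) ≢ false
    refute fails = contradiction (trans (sym holds) fails) λ ()

  ∀∀-distinct : let ψ = sentence (q ∷ ∀q ∷ ∀q ∷ []) θ in
                NonReplicating ψ → NonReplicating (negS ψ) →
                (Distinct A x y z → θ (typeOf A v) ≡ true) → θ (typeOf A v) ≡ true
  ∀∀-distinct nr nr¬ onDistinct = byCases (_≟_ A x y) (_≟_ A x z) (_≟_ A y z)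
    where
    coincide : ∀ i j → i < j → lookup v i ≡ lookup v j →
               θ (typeOf A v) ≡ isUniversal (lookup (q ∷ ∀q ∷ ∀q ∷ []) j)
    coincide = matrix-coincidence (sentence (q ∷ ∀q ∷ ∀q ∷ []) θ) nr nr¬ A v

    byCases : Dec (x ≡ y) → Dec (x ≡ z) → Dec (y ≡ z) → θ (typeOf A v) ≡ true
    byCases (yes x≡y) _ _ = coincide (# 0) (# 1) (s≤s z≤n) x≡y
    byCases (no _) (yes x≡z) _ = coincide (# 0) (# 2) (s≤s z≤n) x≡z
    byCases (no _) (no _) (yes y≡z) = coincide (# 1) (# 2) (s≤s (s≤s z≤n)) y≡z
    byCases (no x≢y) (no x≢z) (no y≢z) = onDistinct (x≢y , x≢z , y≢z)

-- One truth value of `θ`, on a constant triple, is read off through two different pairs.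
lastTwoAgree : ∀ q₁ q₂ q₃ θ → let ψ = sentence (q₁ ∷ q₂ ∷ q₃ ∷ []) θ in
               ∀ A → Carrier A → NonReplicating ψ → NonReplicating (negS ψ) →
               isUniversal q₂ ≡ isUniversal q₃
lastTwoAgree q₁ q₂ q₃ θ A x nr nr¬ =
  trans (sym (coincide (# 0) (# 1) (s≤s z≤n) refl)) (coincide (# 0) (# 2) (s≤s z≤n) refl)
  where
  v : Vec _ 3
  v = x ∷ x ∷ x ∷ []

  coincide : ∀ i j → i < j → lookup v i ≡ lookup v j →
             θ (typeOf A v) ≡ isUniversal (lookup (q₁ ∷ q₂ ∷ q₃ ∷ []) j)
  coincide = matrix-coincidence (sentence (q₁ ∷ q₂ ∷ q₃ ∷ []) θ) nr nr¬ A v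

-- Duplicator's answers

-- The last two quantifiers agree and so act as one block: `y′` may depend on `z`. This is what
-- Duplicator gains over the game, where Spoiler changes sides between the last two rounds.
Answers : (A B : Structure) → Carrier A → Carrier B → Set
Answers A B x x′ = ∀ y z → Distinct A x y z →
  ∃₂ λ y′ z′ → typeOf A (x ∷ y ∷ z ∷ []) ≡ typeOf B (x′ ∷ y′ ∷ z′ ∷ [])

TriplesEmbed : (A B : Structure) → Set
TriplesEmbed A B = ∀ x y z → Distinct A x y z →
  ∃ λ x′ → ∃₂ λ y′ z′ → typeOf A (x ∷ y ∷ z ∷ []) ≡ typeOf B (x′ ∷ y′ ∷ z′ ∷ [])

module _ (A B : Structure) (finA : Finite (Carrier A)) (finB : Finite (Carrier B)) where

  answers? : ∀ x x′ → Dec (Answers A B x x′)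
  answers? x x′ = ∀? finA λ y → ∀? finA λ z → distinct? A x y z →-dec
    (∃? finB λ y′ → ∃? finB λ z′ →
      typeOf A (x ∷ y ∷ z ∷ []) ≟Ty typeOf B (x′ ∷ y′ ∷ z′ ∷ []))

  triplesEmbed? : Dec (TriplesEmbed A B)
  triplesEmbed? = ∀? finA λ x → ∀? finA λ y → ∀? finA λ z → distinct? A x y z →-dec
    (∃? finB λ x′ → ∃? finB λ y′ → ∃? finB λ z′ →
      typeOf A (x ∷ y ∷ z ∷ []) ≟Ty typeOf B (x′ ∷ y′ ∷ z′ ∷ []))

-- Opaque, so that comparing the answers does not rerun the search.
opaque
  answersToRT4 : ∀ x′ → ∃ λ x → Answers RT4 RT3 x x′
  answersToRT4 = from-yes (∀? finiteRT3 λ x′ → ∃? finiteRT4 λ x →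
    answers? RT4 RT3 finiteRT4 finiteRT3 x x′)

  answersToRT3 : ∀ x → ∃ λ x′ → Answers RT3 RT4 x′ x
  answersToRT3 = from-yes (∀? finiteRT4 λ x → ∃? finiteRT3 λ x′ →
    answers? RT3 RT4 finiteRT3 finiteRT4 x′ x)

  RT4-embeds-RT3 : TriplesEmbed RT4 RT3
  RT4-embeds-RT3 = from-yes (triplesEmbed? RT4 RT3 finiteRT4 finiteRT3)

  RT3-embeds-RT4 : TriplesEmbed RT3 RT4
  RT3-embeds-RT4 = from-yes (triplesEmbed? RT3 RT4 finiteRT3 finiteRT4)

transfer : (ψ : Sentence 3) → NonReplicating ψ → NonReplicating (negS ψ) → RT4 ⊨ ψ → RT3 ⊨ ψ
transfer (sentence (q ∷ ∀q ∷ ∃q ∷ []) θ) nr nr¬ _ =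
  contradiction (lastTwoAgree q ∀q ∃q θ RT4 B1 nr nr¬) λ ()
transfer (sentence (q ∷ ∃q ∷ ∀q ∷ []) θ) nr nr¬ _ =
  contradiction (lastTwoAgree q ∃q ∀q θ RT4 B1 nr nr¬) λ ()
transfer (sentence (∃q ∷ ∃q ∷ ∃q ∷ []) θ) nr nr¬ (x , y , z , holds) =
  let x′ , y′ , z′ , same = RT4-embeds-RT3 x y z (∃∃-distinct ∃q θ RT4 x y z nr nr¬ holds)
  in x′ , y′ , z′ , trans (cong θ (sym same)) holds
transfer (sentence (∀q ∷ ∃q ∷ ∃q ∷ []) θ) nr nr¬ holds x′ =
  -- The challenge `x′` lies in `RT3`, but the witnesses `y`, `z` are found in `RT4`, so triples are
  -- carried from `RT4` to `RT3`.
  let x , answer     = answersToRT4 x′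
      y , z , holds′ = holds x
      y′ , z′ , same = answer y z (∃∃-distinct ∀q θ RT4 x y z nr nr¬ holds′)
  in y′ , z′ , trans (cong θ (sym same)) holds′
transfer (sentence (∀q ∷ ∀q ∷ ∀q ∷ []) θ) nr nr¬ holds x′ y′ z′ =
  ∀∀-distinct ∀q θ RT3 x′ y′ z′ nr nr¬ λ distinct →
    let x , y , z , same = RT3-embeds-RT4 x′ y′ z′ distinct
    in trans (cong θ same) (holds x y z)
transfer (sentence (∃q ∷ ∀q ∷ ∀q ∷ []) θ) nr nr¬ (x , holds) =
  -- Now the challenges `y′`, `z′` arise in `RT3`, so triples are carried the other way.
  let x′ , answer = answersToRT3 x in
  x′ , λ y′ z′ → ∀∀-distinct ∃q θ RT3 x′ y′ z′ nr nr¬ λ distinct →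
    let y , z , same = answer y′ z′ distinct
    in trans (cong θ same) (holds y z)

theorem4p10 : SpoilerWinsMS 3 true RT4 RT3 ×
    ¬ (Σ (Sentence 3) λ ψ →
    Separates ψ RT4 RT3 × NonReplicating ψ × NonReplicating (negS ψ))
theorem4p10 = spoilerWins ,
  λ (ψ , (RT4⊨ψ , ¬RT3⊨ψ) , nr , nr¬) → ¬RT3⊨ψ (transfer ψ nr nr¬ RT4⊨ψ)
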